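{- Let $U$ be a coherent $P$-ultrafilter on $\mathbb{C}_\omega$ such that $U\cap\{a_i:i<\omega\}=\emptyset$. Then for every monotonic function $g\colon U\to\mathbb{C}_\omega$ there exist $x\in U$, a strictly increasing function $\varphi\colon\omega\to\omega$, and a monotonic function $g^*\colon C_\varphi\to\mathbb{C}_\omega$ represented by a basic map such that $g^*\upharpoonright(U\upharpoonright x)=g\upharpoonright(C_\varphi\cap U\upharpoonright x)$, i.e. $g^*(c)=g(c)$ for every $c\in C_\varphi\cap U$ with $c\le x$.
   Context: $\mathbb{C}_\omega$ is the Cohen algebra, the unique atomless complete Boolean algebra with a countable dense subalgebra. Fix an enumeration $\{d_k:k<\omega\}$ of a countable dense subalgebra with $d_0=\mathbb{0}$, and fix an infinite maximal antichain $\{a_i:i<\omega\}$ in $\mathbb{C}_\omega$. For a strictly increasing $\varphi\colon\omega\to\omega$, $C_\varphi$ is the set of all $c\in\mathbb{C}_\omega$ for which there exists a strictly increasing sequence $\langle m_j:j<\omega\rangle$ with $\{a_i\wedge c: i<\varphi(m_j)\}\subseteq\{d_k:k<\varphi(m_j)\}$ for all $j$. For $B\subseteq\mathbb{C}_\omega$ and $x\in\mathbb{C}_\omega$, $B\upharpoonright x=\{b\in B:b\le x\}$. A function $g$ defined on a subset of a Boolean algebra with values in a Boolean algebra is monotonic if $v_1\le v_2$ implies $g(v_1)\le g(v_2)$. For $c\in\mathbb{C}_\omega$ and $\ell<\omega$, $c^\ell=\bigvee\{a_i\wedge c:i<\ell\}\vee\bigvee\{a_i:i\ge\ell\}$. A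 function $f\colon C\to\mathbb{C}_\omega$ ($C\subseteq\mathbb{C}_\omega$) is represented by a basic map if there is a map $\hat f\colon\{c^\ell:c\in C,\ \ell<\omega\}\to\mathbb{C}_\omega$ with $f(c)=\bigwedge\{\hat f(c^\ell):\ell<\omega\}$ for all $c\in C$. An ultrafilter $U$ on a complete c.c.c. Boolean algebra $\mathbb{B}$ is a coherent $P$-ultrafilter if for every maximal antichain $P$ and every family $\{X_n:n<\omega\}$ of subsets of $P$ with $\bigvee X_n\in U$ for all $n$, there exists $Y\subseteq P$ with $\bigvee Y\in U$ and $Y\setminus X_n$ finite for all $n$. -}

module Defs where

open import Level using (Level; _⊔_; Lift) renaming (suc to lsuc)
open import Data.Nat using (ℕ; zero; suc; _<_; _≤_)
open import Data.Product using (Σ; Σ-syntax; ∃; ∃-syntax; _×_; _,_)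
open import Data.Sum using (_⊎_)
open import Data.List using (List)
open import Data.List.Relation.Unary.Any using (Any)
open import Relation.Nullary using () renaming (¬_ to Not)
open import Relation.Binary.PropositionalEquality using (_≡_)
open import Algebra.Lattice.Bundles using (BooleanAlgebra)

record CompleteBooleanAlgebra (c ℓ : Level) : Set (lsuc (c ⊔ ℓ)) where
  field
    boolAlg : BooleanAlgebra c ℓ
  open BooleanAlgebra boolAlg public
  _≤ᴮ_ : Carrier → Carrier → Set ℓ
  x ≤ᴮ y = (x ∧ y) ≈ x
  field
    ⋁      : (Carrier → Set (c ⊔ ℓ)) → Carrier
    ⋁-ub   : ∀ S x → S x → x ≤ᴮ ⋁ S
    ⋁-least : ∀ S u → (∀ x → S x → x ≤ᴮ u) → ⋁ S ≤ᴮ u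
    ⋀      : (Carrier → Set (c ⊔ ℓ)) → Carrier
    ⋀-lb   : ∀ S x → S x → ⋀ S ≤ᴮ x
    ⋀-greatest : ∀ S u → (∀ x → S x → u ≤ᴮ x) → u ≤ᴮ ⋀ S

StrictlyIncreasing : (ℕ → ℕ) → Set
StrictlyIncreasing φ = ∀ i j → i < j → φ i < φ j

module Ops {c ℓ : Level} (B : CompleteBooleanAlgebra c ℓ) where
  open CompleteBooleanAlgebra B renaming (¬_ to compl)

  Pred : Set (lsuc (c ⊔ ℓ))
  Pred = Carrier → Set (c ⊔ ℓ)

  _⊆_ : Pred → Pred → Set (c ⊔ ℓ)
  X ⊆ Y = ∀ x → X x → Y x

  Nonzero : Carrier → Set ℓ
  Nonzero x = Not (x ≈ ⊥)

  Atomless : Set (c ⊔ ℓ)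
  Atomless = ∀ x → Nonzero x → Σ[ y ∈ Carrier ] (y ≤ᴮ x × Nonzero y × Not (y ≈ x))

  IsDenseSubalgebraEnum : (ℕ → Carrier) → Set (c ⊔ ℓ)
  IsDenseSubalgebraEnum d =
      (d 0 ≈ ⊥)
    × (Σ[ k ∈ ℕ ] d k ≈ ⊤)
    × (∀ k l → Σ[ m ∈ ℕ ] d m ≈ (d k ∧ d l))
    × (∀ k l → Σ[ m ∈ ℕ ] d m ≈ (d k ∨ d l))
    × (∀ k → Σ[ m ∈ ℕ ] d m ≈ (compl (d k)))
    × (∀ x → Nonzero x → Σ[ k ∈ ℕ ] (Nonzero (d k) × d k ≤ᴮ x))

  -- B is (a copy of) the Cohen algebra ℂ_ω, witnessed by the enumeration d:
  -- atomless complete Boolean algebra with countable dense subalgebra {d k}.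
  IsCohenWith : (ℕ → Carrier) → Set (c ⊔ ℓ)
  IsCohenWith d = Atomless × IsDenseSubalgebraEnum d

  IsMaxAntichainSeq : (ℕ → Carrier) → Set (c ⊔ ℓ)
  IsMaxAntichainSeq a =
      (∀ i → Nonzero (a i))
    × (∀ i j → Not (i ≡ j) → (a i ∧ a j) ≈ ⊥)
    × (∀ x → Nonzero x → Σ[ i ∈ ℕ ] Nonzero (a i ∧ x))

  IsMaxAntichain : Pred → Set (c ⊔ ℓ)
  IsMaxAntichain P =
      (∀ x → P x → Nonzero x)
    × (∀ x y → P x → P y → Not (x ≈ y) → (x ∧ y) ≈ ⊥)
    × (∀ x → Nonzero x → Σ[ y ∈ Carrier ] (P y × Nonzero (y ∧ x)))

  IsUltrafilter : Pred → Set (c ⊔ ℓ)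
  IsUltrafilter U =
      U ⊤
    × Not (U ⊥)
    × (∀ x y → U x → x ≤ᴮ y → U y)
    × (∀ x y → U x → U y → U (x ∧ y))
    × (∀ x → U x ⊎ U (compl x))

  FiniteSet : Pred → Set (c ⊔ ℓ)
  FiniteSet X = Σ[ L ∈ List Carrier ] (∀ x → X x → Any (x ≈_) L)

  _∖_ : Pred → Pred → Pred
  (Y ∖ X) x = Y x × Not (X x)

  IsCoherentPUltrafilter : Pred → Set (lsuc (c ⊔ ℓ))
  IsCoherentPUltrafilter U =
      IsUltrafilter U
    × (∀ (P : Pred) → IsMaxAntichain P →
         ∀ (X : ℕ → Pred) → (∀ n → X n ⊆ P) → (∀ n → U (⋁ (X n))) →
         Σ[ Y ∈ Pred ] (Y ⊆ P × U (⋁ Y) × (∀ n → FiniteSet (Y ∖ X n))))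

  Cφ : (ℕ → Carrier) → (ℕ → Carrier) → (ℕ → ℕ) → Pred
  Cφ d a φ c' = Lift (c ⊔ ℓ) (Σ[ m ∈ (ℕ → ℕ) ] (StrictlyIncreasing m ×
      (∀ j i → i < φ (m j) → Σ[ k ∈ ℕ ] (k < φ (m j) × (a i ∧ c') ≈ d k))))

  power : (ℕ → Carrier) → Carrier → ℕ → Carrier
  power a c' l = ⋁ (λ y → Lift (c ⊔ ℓ) (Σ[ i ∈ ℕ ] (i < l × y ≡ (a i ∧ c'))))
               ∨ ⋁ (λ y → Lift (c ⊔ ℓ) (Σ[ i ∈ ℕ ] (l ≤ i × y ≡ a i)))

  PFun : Pred → Set (c ⊔ ℓ)
  PFun D = (x : Carrier) → D x → Carrier

  Monotonic : (D : Pred) → PFun D → Set (c ⊔ ℓ)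
  Monotonic D g = ∀ x y (dx : D x) (dy : D y) → x ≤ᴮ y → g x dx ≤ᴮ g y dy

  -- f : C → B is represented by a basic map: there is fhat (a function on
  -- the carrier respecting ≈; only its values on {c^l : c ∈ C} matter)
  -- with f(c) = ⋀ { fhat (c^l) : l < ω }.
  RepresentedByBasicMap : (ℕ → Carrier) → (C : Pred) → PFun C → Set (c ⊔ ℓ)
  RepresentedByBasicMap a C f =
    Σ[ fhat ∈ (Carrier → Carrier) ]
      ((∀ x y → x ≈ y → fhat x ≈ fhat y)
      × (∀ c' (cc : C c') →
           f c' cc ≈ ⋀ (λ z → Lift (c ⊔ ℓ) (Σ[ l ∈ ℕ ] z ≡ fhat (power a c' l)))))

{-# OPTIONS --safe #-}

-- Countably many members z₀, z₁, … of U have a pseudo-intersection x ∈ U, in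
-- the sense that x ∧ aᵢ ≤ zₙ for all i ≥ h n: replace the zₙ by a decreasing
-- sequence and apply coherence to the common refinement of {aᵢ} and of the
-- partition into the successive differences (together with the meet).
--
-- For ℓ < ω there are finitely many patterns ⟨aᵢ ∧ c : i < ℓ⟩ with values in
-- {d_k : k < ℓ}.  For each pattern and each k < ℓ pick, if possible, y ∈ U with
-- that pattern and g(y) ∧ d_k = 0; let z_ℓ be the meet of these y.  If φ grows
-- fast enough, and x also omits the aᵢ in alternate intervals determined by φ,
-- then x ∧ aᵢ ≤ z_ℓ for all i ≥ ℓ = φ(t).  So when c ≤ x has a pattern at such
-- an ℓ and g(c) ∧ d_k = 0, we get c^ℓ ∧ x ≤ y and thus g(c^ℓ ∧ x) ∧ d_k = 0.
-- As {d_k} is dense, g(c) = ⋀ g(c^ℓ ∧ x) on C_φ ∩ U ↾ x, and the right-hand side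
-- makes sense on all of C_φ because c^ℓ ∧ x ∈ U for every c.
module Submission where

open import Defs
open import Level using (Level; _⊔_; Lift; lift; lower)
open import Data.Nat using (ℕ; zero; suc; _+_; _<_; _≤_; z≤n; s≤s; s≤s⁻¹)
import Data.Nat as ℕ
import Data.Nat.Properties as ℕₚ
open import Data.Product using (Σ-syntax; _×_; _,_; proj₁; proj₂)
open import Data.Sum using (_⊎_; inj₁; inj₂; [_,_]′)
open import Data.Empty using (⊥-elim)
open import Data.List using (List; []; _∷_)
open import Data.List.Relation.Unary.Any using (Any; here; there)
open import Function using (_∘_)
open import Relation.Nullary using (Dec; yes; no) renaming (¬_ to Not)
open import Relation.Nullary.Decidable using (decidable-stable)
import Relation.Nullary.Decidable as Dec
open import Relation.Binary.Definitions using (tri<; tri≈; tri>)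
open import Relation.Binary.PropositionalEquality using (_≡_; refl)
open import Axiom.ExcludedMiddle using (ExcludedMiddle)
import Algebra.Lattice.Properties.BooleanAlgebra as BooleanAlgebraProperties

module _ {φ : ℕ → ℕ} (φ-step : ∀ n → φ n < φ (suc n)) where

  step⇒mono : ∀ {i j} → i ≤ j → φ i ≤ φ j
  step⇒mono {i} {zero} z≤n = ℕₚ.≤-refl
  step⇒mono {i} {suc j} i≤1+j with ℕₚ.m≤n⇒m<n∨m≡n i≤1+j
  ... | inj₁ i<1+j = ℕₚ.≤-trans (step⇒mono (s≤s⁻¹ i<1+j)) (ℕₚ.<⇒≤ (φ-step j))
  ... | inj₂ refl  = ℕₚ.≤-refl

  step⇒strictlyIncreasing : StrictlyIncreasing φ
  step⇒strictlyIncreasing i j i<j = ℕₚ.≤-trans (φ-step i) (step⇒mono i<j)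

strictlyIncreasing⇒≥id : ∀ {φ} → StrictlyIncreasing φ → ∀ n → n ≤ φ n
strictlyIncreasing⇒≥id φ↑ zero    = z≤n
strictlyIncreasing⇒≥id φ↑ (suc n) =
  ℕₚ.≤-trans (s≤s (strictlyIncreasing⇒≥id φ↑ n)) (φ↑ n (suc n) ℕₚ.≤-refl)

-- Order calculus in a complete Boolean algebra

module Order {c ℓ : Level} (B : CompleteBooleanAlgebra c ℓ) where
  open CompleteBooleanAlgebra B renaming (¬_ to compl; refl to ≈-refl; sym to ≈-sym; trans to ≈-trans)
  open BooleanAlgebraProperties boolAlg

  ≤-reflexive : ∀ {x y} → x ≈ y → x ≤ᴮ y
  ≤-reflexive {x} x≈y = ≈-trans (∧-cong ≈-refl (≈-sym x≈y)) (∧-idem x)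

  ≤-refl : ∀ {x} → x ≤ᴮ x
  ≤-refl = ≤-reflexive ≈-refl

  ≤-trans : ∀ {x y z} → x ≤ᴮ y → y ≤ᴮ z → x ≤ᴮ z
  ≤-trans {x} {y} {z} x≤y y≤z =
    ≈-trans (∧-cong (≈-sym x≤y) ≈-refl)
      (≈-trans (∧-assoc x y z) (≈-trans (∧-cong ≈-refl y≤z) x≤y))

  ≤-antisym : ∀ {x y} → x ≤ᴮ y → y ≤ᴮ x → x ≈ y
  ≤-antisym {x} {y} x≤y y≤x = ≈-trans (≈-sym x≤y) (≈-trans (∧-comm x y) y≤x)

  x∧y≤x : ∀ {x y} → (x ∧ y) ≤ᴮ x
  x∧y≤x {x} {y} = ≈-trans (∧-comm (x ∧ y) x)
    (≈-trans (≈-sym (∧-assoc x x y)) (∧-cong (∧-idem x) ≈-refl))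

  x∧y≤y : ∀ {x y} → (x ∧ y) ≤ᴮ y
  x∧y≤y {x} {y} = ≈-trans (∧-assoc x y y) (∧-cong ≈-refl (∧-idem y))

  ∧-greatest : ∀ {x y z} → x ≤ᴮ y → x ≤ᴮ z → x ≤ᴮ (y ∧ z)
  ∧-greatest {x} {y} {z} x≤y x≤z =
    ≈-trans (≈-sym (∧-assoc x y z)) (≈-trans (∧-cong x≤y ≈-refl) x≤z)

  ∧-mono : ∀ {x y u v} → x ≤ᴮ y → u ≤ᴮ v → (x ∧ u) ≤ᴮ (y ∧ v)
  ∧-mono x≤y u≤v = ∧-greatest (≤-trans x∧y≤x x≤y) (≤-trans x∧y≤y u≤v)

  x≤x∨y : ∀ {x y} → x ≤ᴮ (x ∨ y)
  x≤x∨y {x} {y} = ∧-absorbs-∨ x y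

  y≤x∨y : ∀ {x y} → y ≤ᴮ (x ∨ y)
  y≤x∨y {x} {y} = ≤-trans x≤x∨y (≤-reflexive (∨-comm y x))

  ∨-least : ∀ {x y z} → x ≤ᴮ z → y ≤ᴮ z → (x ∨ y) ≤ᴮ z
  ∨-least {x} {y} {z} x≤z y≤z = ≈-trans (∧-distribʳ-∨ z x y) (∨-cong x≤z y≤z)

  ⊥-least : ∀ {x} → ⊥ ≤ᴮ x
  ⊥-least {x} = ∧-zeroˡ x

  ⊤-greatest : ∀ {x} → x ≤ᴮ ⊤
  ⊤-greatest {x} = ∧-identityʳ x

  ≤⊥⇒≈⊥ : ∀ {x} → x ≤ᴮ ⊥ → x ≈ ⊥
  ≤⊥⇒≈⊥ x≤⊥ = ≤-antisym x≤⊥ ⊥-least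

  ≤-disjoint : ∀ {x y} → x ≤ᴮ y → x ≤ᴮ compl y → x ≈ ⊥
  ≤-disjoint {x} {y} x≤y x≤¬y =
    ≤⊥⇒≈⊥ (≤-trans (∧-greatest x≤y x≤¬y) (≤-reflexive (∧-complementʳ y)))

  -- `compl y ∨ z` is the Boolean implication. The adjunction lets `⋁-least` be applied under a
  -- meet, in place of infinite distributivity.
  curry : ∀ {x y z} → (x ∧ y) ≤ᴮ z → x ≤ᴮ (compl y ∨ z)
  curry {x} {y} {z} x∧y≤z =
    ≤-trans (∧-greatest ≤-refl (≤-trans ⊤-greatest (≤-reflexive (≈-sym (∨-complementʳ y)))))
      (≤-trans (≤-reflexive (∧-distribˡ-∨ x y (compl y)))
        (∨-least (≤-trans x∧y≤z y≤x∨y) (≤-trans x∧y≤y x≤x∨y)))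

  uncurry : ∀ {x y z} → x ≤ᴮ (compl y ∨ z) → (x ∧ y) ≤ᴮ z
  uncurry {x} {y} {z} x≤ =
    ≤-trans (∧-greatest (≤-trans x∧y≤x x≤) x∧y≤y)
      (≤-trans (≤-reflexive (∧-distribʳ-∨ y (compl y) z))
        (∨-least (≤-trans (≤-reflexive (∧-complementˡ y)) ⊥-least) x∧y≤x))

  ∧≈⊥⇒≤compl : ∀ {x y} → (x ∧ y) ≈ ⊥ → x ≤ᴮ compl y
  ∧≈⊥⇒≤compl {x} {y} x∧y≈⊥ =
    ≤-trans (curry (≤-reflexive x∧y≈⊥)) (≤-reflexive (∨-identityʳ (compl y)))

  ∧compl≈⊥⇒≤ : ∀ {x y} → (x ∧ compl y) ≈ ⊥ → x ≤ᴮ y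
  ∧compl≈⊥⇒≤ {x} {y} p = ≤-trans (∧≈⊥⇒≤compl p) (≤-reflexive (¬-involutive y))

module CoherentPUltrafilter {c ℓ : Level} (em : ExcludedMiddle (c ⊔ ℓ))
  (B : CompleteBooleanAlgebra c ℓ)
  (a : ℕ → CompleteBooleanAlgebra.Carrier B) (a-max : Ops.IsMaxAntichainSeq B a)
  (U : Ops.Pred B) (U-coh : Ops.IsCoherentPUltrafilter B U) where

  open CompleteBooleanAlgebra B renaming (¬_ to compl; refl to ≈-refl; sym to ≈-sym; trans to ≈-trans)
  open Ops B
  open Order B

  private
    U-⊤ : U ⊤
    U-⊤ = proj₁ (proj₁ U-coh)

    U-⊥ : Not (U ⊥)
    U-⊥ = proj₁ (proj₂ (proj₁ U-coh))

    U-up : ∀ {x y} → U x → x ≤ᴮ y → U y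
    U-up = proj₁ (proj₂ (proj₂ (proj₁ U-coh))) _ _

    U-∧ : ∀ {x y} → U x → U y → U (x ∧ y)
    U-∧ = proj₁ (proj₂ (proj₂ (proj₂ (proj₁ U-coh)))) _ _

    U-ultra : ∀ x → U x ⊎ U (compl x)
    U-ultra = proj₂ (proj₂ (proj₂ (proj₂ (proj₁ U-coh))))

    a-disjoint : ∀ {i j} → Not (i ≡ j) → (a i ∧ a j) ≈ ⊥
    a-disjoint = proj₁ (proj₂ a-max) _ _

    a-meets : ∀ x → Nonzero x → Σ[ i ∈ ℕ ] Nonzero (a i ∧ x)
    a-meets = proj₂ (proj₂ a-max)

  U-disjoint : ∀ {x} → U x → Not (U (compl x))
  U-disjoint ux u¬x = U-⊥ (U-up (U-∧ ux u¬x) (≤-reflexive (≤-disjoint x∧y≤x x∧y≤y)))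

  ≈-dec : ∀ x y → Dec (x ≈ y)
  ≈-dec x y = Dec.map′ lower lift (em {Lift c (x ≈ y)})

  ≰⇒nonzero : ∀ {x y} → Not (x ≤ᴮ y) → Nonzero (x ∧ compl y)
  ≰⇒nonzero x≰y = x≰y ∘ ∧compl≈⊥⇒≤

  ≤-stable : ∀ {x y} → (Nonzero (x ∧ compl y) → x ≤ᴮ y) → x ≤ᴮ y
  ≤-stable {x} {y} f with ≈-dec (x ∧ compl y) ⊥
  ... | yes p = ∧compl≈⊥⇒≤ p
  ... | no p  = f p

  -- A nonzero part of `x` outside `y` would meet some `a i`, by maximality.
  ≤-piecewise : ∀ {x y} → (∀ i → (a i ∧ x) ≤ᴮ y) → x ≤ᴮ y
  ≤-piecewise {x} {y} h = ≤-stable λ nz →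
    let i , nzᵢ = a-meets _ nz in
    ⊥-elim (nzᵢ (≤-disjoint (≤-trans (∧-mono ≤-refl x∧y≤x) (h i)) (≤-trans x∧y≤y x∧y≤y)))

  -- Pseudo-intersections

  module _ (y : ℕ → Carrier) (y-U : ∀ n → U (y n)) (y-zero : y 0 ≈ ⊤)
    (y-step : ∀ n → y (suc n) ≤ᴮ y n) where

    private
      yω : Carrier
      yω = ⋀ λ z → Lift (c ⊔ ℓ) (Σ[ n ∈ ℕ ] z ≡ y n)

      yω≤ : ∀ n → yω ≤ᴮ y n
      yω≤ n = ⋀-lb _ _ (lift (n , refl))

      y-anti : ∀ {m n} → m ≤ n → y n ≤ᴮ y m
      y-anti {n = zero}  z≤n = ≤-refl
      y-anti {m} {suc n} m≤1+n with ℕₚ.m≤n⇒m<n∨m≡n m≤1+n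
      ... | inj₁ m<1+n = ≤-trans (y-step n) (y-anti (s≤s⁻¹ m<1+n))
      ... | inj₂ refl  = ≤-refl

      -- The partition of unity induced by the sequence: its total meet, then the successive
      -- differences. They exhaust `⊤` because `y 0 ≈ ⊤`.
      piece : ℕ → Carrier
      piece zero    = yω
      piece (suc m) = y m ∧ compl (y (suc m))

      piece-decides : ∀ m n → piece m ≤ᴮ y n ⊎ piece m ≤ᴮ compl (y n)
      piece-decides zero n = inj₁ (yω≤ n)
      piece-decides (suc m) n with n ℕ.≤? m
      ... | yes n≤m = inj₁ (≤-trans x∧y≤x (y-anti n≤m))
      ... | no n≰m  = inj₂ (∧≈⊥⇒≤compl (≤-disjoint
              (≤-trans x∧y≤y (y-anti (ℕₚ.≰⇒> n≰m))) (≤-trans x∧y≤x x∧y≤y)))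

      piece-disjoint-< : ∀ {m n} → m < n → ∀ {z} → z ≤ᴮ piece m → z ≤ᴮ piece n → z ≈ ⊥
      piece-disjoint-< {zero}  {suc n} _         z≤ z≤′ =
        ≤-disjoint (≤-trans z≤ (yω≤ (suc n))) (≤-trans z≤′ x∧y≤y)
      piece-disjoint-< {suc m} {suc n} (s≤s m<n) z≤ z≤′ =
        ≤-disjoint (≤-trans z≤′ (≤-trans x∧y≤x (y-anti m<n))) (≤-trans z≤ x∧y≤y)

      -- Descends to the first term that `w` fails to lie below; the difference ending in that term
      -- then meets `w`.
      piece-meets-≰ : ∀ {w} m → Not (w ≤ᴮ y m) → Σ[ n ∈ ℕ ] Nonzero (piece n ∧ w)
      piece-meets-≰ zero w≰ =
        ⊥-elim (w≰ (≤-trans ⊤-greatest (≤-reflexive (≈-sym y-zero))))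
      piece-meets-≰ {w} (suc m) w≰ with ≈-dec (w ∧ y m) w
      ... | no w≰ym  = piece-meets-≰ m w≰ym
      ... | yes w≤ym = suc m , λ p → ≰⇒nonzero w≰ (≤⊥⇒≈⊥ (≤-trans
              (∧-greatest (∧-greatest (≤-trans x∧y≤x w≤ym) x∧y≤y) x∧y≤x) (≤-reflexive p)))

      piece-meets : ∀ w → Nonzero w → Σ[ n ∈ ℕ ] Nonzero (piece n ∧ w)
      piece-meets w nz with em {Lift (c ⊔ ℓ) (Σ[ m ∈ ℕ ] Not (w ≤ᴮ y m))}
      ... | yes (lift (m , w≰)) = piece-meets-≰ m w≰
      ... | no ∄m = 0 , λ p → nz (≤⊥⇒≈⊥ (≤-trans (∧-greatest w≤yω ≤-refl) (≤-reflexive p)))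
        where
        w≤yω : w ≤ᴮ yω
        w≤yω = ⋀-greatest _ _ λ { _ (lift (n , refl)) →
          decidable-stable (≈-dec _ _) λ w≰ → ∄m (lift (n , w≰)) }

      -- The common refinement of the two partitions, with the empty cells discarded as an antichain
      -- requires.
      P : Pred
      P x = Nonzero x × Σ[ i ∈ ℕ ] Σ[ m ∈ ℕ ] Lift c (x ≈ (a i ∧ piece m))

      P-maxAntichain : IsMaxAntichain P
      P-maxAntichain = (λ _ → proj₁) , disjoint , meets
        where
        disjoint : ∀ x z → P x → P z → Not (x ≈ z) → (x ∧ z) ≈ ⊥
        disjoint x z (_ , i , m , lift x≈) (_ , j , n , lift z≈) x≉z with i ℕ.≟ j
        ... | no i≢j = ≤⊥⇒≈⊥ (≤-trans
                (∧-mono (≤-trans (≤-reflexive x≈) x∧y≤x) (≤-trans (≤-reflexive z≈) x∧y≤x))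
                (≤-reflexive (a-disjoint i≢j)))
        ... | yes refl with ℕₚ.<-cmp m n
        ...   | tri≈ _ refl _ = ⊥-elim (x≉z (≈-trans x≈ (≈-sym z≈)))
        ...   | tri< m<n _ _  = piece-disjoint-< m<n
                  (≤-trans x∧y≤x (≤-trans (≤-reflexive x≈) x∧y≤y))
                  (≤-trans x∧y≤y (≤-trans (≤-reflexive z≈) x∧y≤y))
        ...   | tri> _ _ n<m  = piece-disjoint-< n<m
                  (≤-trans x∧y≤y (≤-trans (≤-reflexive z≈) x∧y≤y))
                  (≤-trans x∧y≤x (≤-trans (≤-reflexive x≈) x∧y≤y))

        meets : ∀ x → Nonzero x → Σ[ z ∈ Carrier ] (P z × Nonzero (z ∧ x))
        meets x nz with a-meets x nz
        ... | i , nzᵢ with piece-meets _ nzᵢ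
        ... | m , nzₘ = a i ∧ piece m ,
              ((λ p → nzₘ (≤⊥⇒≈⊥ (≤-trans (≤-trans below x∧y≤x) (≤-reflexive p)))) , i , m , lift ≈-refl) ,
              (λ p → nzₘ (≤⊥⇒≈⊥ (≤-trans below (≤-reflexive p))))
          where
          below : (piece m ∧ (a i ∧ x)) ≤ᴮ ((a i ∧ piece m) ∧ x)
          below = ∧-greatest (∧-greatest (≤-trans x∧y≤y x∧y≤x) x∧y≤x) (≤-trans x∧y≤y x∧y≤y)

      X : ℕ → Pred
      X n x = P x × (x ≤ᴮ y n)

      -- By `piece-decides` no cell straddles `y n`, so no cell can meet a part of `y n` left
      -- uncovered by `X n`.
      U-⋁X : ∀ n → U (⋁ (X n))
      U-⋁X n = U-up (y-U n) (≤-stable λ nz → ⊥-elim (refute nz))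
        where
        refute : Not (Nonzero (y n ∧ compl (⋁ (X n))))
        refute nz with proj₂ (proj₂ P-maxAntichain) _ nz
        ... | z , Pz@(_ , i , m , lift z≈) , nz′ with piece-decides m n
        ...   | inj₁ ≤y = nz′ (≤-disjoint
                  (≤-trans x∧y≤x (⋁-ub (X n) z (Pz , ≤-trans (≤-reflexive z≈) (≤-trans x∧y≤y ≤y))))
                  (≤-trans x∧y≤y x∧y≤y))
        ...   | inj₂ ≤¬y = nz′ (≤-disjoint (≤-trans x∧y≤y x∧y≤x)
                  (≤-trans x∧y≤x (≤-trans (≤-reflexive z≈) (≤-trans x∧y≤y ≤¬y))))

      -- Turns finiteness into a bound on indices: by disjointness a nonzero element lies below at
      -- most one `a i`, so each list entry accounts for at most one index.
      indexBound : (L : List Carrier) → Σ[ h ∈ ℕ ]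
        (∀ x i → Nonzero x → x ≤ᴮ a i → Any (x ≈_) L → i < h)
      indexBound [] = 0 , λ _ _ _ _ ()
      indexBound (z ∷ L) with indexBound L
                            | em {Lift (c ⊔ ℓ) (Σ[ i ∈ ℕ ] (z ≤ᴮ a i))}
      ... | h , bound | yes (lift (j , z≤aj)) = suc j + h , λ where
              x i nz x≤ai (here x≈z) → ℕₚ.≤-trans
                (s≤s (ℕₚ.≤-reflexive (decidable-stable (i ℕ.≟ j) λ i≢j → nz (≤⊥⇒≈⊥ (≤-trans
                  (∧-greatest x≤ai (≤-trans (≤-reflexive x≈z) z≤aj)) (≤-reflexive (a-disjoint i≢j)))))))
                (ℕₚ.m≤m+n (suc j) h)
              x i nz x≤ai (there x∈L) → ℕₚ.≤-trans (bound x i nz x≤ai x∈L) (ℕₚ.m≤n+m h (suc j))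
      ... | h , bound | no ∄i = h , λ where
              x i nz x≤ai (here x≈z) →
                ⊥-elim (∄i (lift (i , ≤-trans (≤-reflexive (≈-sym x≈z)) x≤ai)))
              x i nz x≤ai (there x∈L) → bound x i nz x≤ai x∈L

    -- `x` is the join of the set `Y` given by coherence. From `h n` on, every cell of `Y` below
    -- `a i` lies in `X n`, and the other cells of `Y` miss `a i`.
    decreasing-pseudoIntersection : Σ[ x ∈ Carrier ] (U x × Σ[ h ∈ (ℕ → ℕ) ]
      (∀ n i → h n ≤ i → (x ∧ a i) ≤ᴮ y n))
    decreasing-pseudoIntersection
      with proj₂ U-coh P P-maxAntichain X (λ _ _ → proj₁) U-⋁X
    ... | Y , Y⊆P , U-⋁Y , fin = ⋁ Y , U-⋁Y , h , λ n i h≤i →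
            uncurry (⋁-least Y _ λ z Yz → below n i h≤i z Yz (Y⊆P z Yz))
      where
      h : ℕ → ℕ
      h n = proj₁ (indexBound (proj₁ (fin n)))

      below : ∀ n i → h n ≤ i → ∀ z → Y z → P z → z ≤ᴮ (compl (a i) ∨ y n)
      below n i h≤i z Yz Pz@(nz , j , m , lift z≈) with i ℕ.≟ j | ≈-dec (z ∧ y n) z
      ... | no i≢j   | _       = curry (≤-trans
              (∧-greatest x∧y≤y (≤-trans x∧y≤x (≤-trans (≤-reflexive z≈) x∧y≤x)))
              (≤-trans (≤-reflexive (a-disjoint i≢j)) ⊥-least))
      ... | yes refl | yes z≤y = ≤-trans z≤y y≤x∨y
      ... | yes refl | no z≰y  = ⊥-elim (ℕₚ.<⇒≱
              (proj₂ (indexBound (proj₁ (fin n))) z i nz (≤-trans (≤-reflexive z≈) x∧y≤x)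
                (proj₂ (fin n) z (Yz , z≰y ∘ proj₂)))
              h≤i)

  pseudoIntersection : (z : ℕ → Carrier) → (∀ n → U (z n)) →
    Σ[ x ∈ Carrier ] (U x × Σ[ h ∈ (ℕ → ℕ) ] (∀ n i → h n ≤ i → (x ∧ a i) ≤ᴮ z n))
  pseudoIntersection z z-U =
    let x , ux , h , below = decreasing-pseudoIntersection y y-U ≈-refl (λ _ → x∧y≤x)
    -- The shift by one: `y (suc n)`, not `y n`, has `z n` as a factor.
    in x , ux , h ∘ suc , λ n i h≤i → ≤-trans (below (suc n) i h≤i) x∧y≤y
    where
    y : ℕ → Carrier
    y zero    = ⊤
    y (suc n) = y n ∧ z n

    y-U : ∀ n → U (y n)
    y-U zero    = U-⊤
    y-U (suc n) = U-∧ (y-U n) (z-U n)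

  -- Thinning along alternate intervals

  private
    module Sparse (z : ℕ → Carrier) (x₀ : Carrier) (h : ℕ → ℕ)
      (below : ∀ n i → h n ≤ i → (x₀ ∧ a i) ≤ᴮ z n)
      (point : ℕ → ℕ) (point-step : ∀ t → point t < point (suc t))
      (h≤point : ∀ t → h (point t) ≤ point (suc t)) where

      double : ℕ → ℕ
      double zero    = zero
      double (suc t) = suc (suc (double t))

      double-mono : ∀ {s t} → s ≤ t → double s ≤ double t
      double-mono z≤n       = z≤n
      double-mono (s≤s s≤t) = s≤s (s≤s (double-mono s≤t))

      evens odds : ℕ → ℕ
      evens t = point (double t)
      odds t  = point (suc (double t))

      evens↑ : StrictlyIncreasing evens
      evens↑ = step⇒strictlyIncreasing λ t →
        ℕₚ.<-trans (point-step (double t)) (point-step (suc (double t)))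

      odds↑ : StrictlyIncreasing odds
      odds↑ = step⇒strictlyIncreasing λ t →
        ℕₚ.<-trans (point-step (suc (double t))) (point-step (suc (suc (double t))))

      InEvenInterval : ℕ → Set
      InEvenInterval i = Σ[ t ∈ ℕ ] (evens t ≤ i × i < odds t)

      odd-notInEvenInterval : ∀ {t i} → odds t ≤ i → i < evens (suc t) → Not (InEvenInterval i)
      odd-notInEvenInterval {t} {i} odd≤i i<even (s , even≤i , i<odd) with s ℕ.≤? t
      ... | yes s≤t = ℕₚ.<⇒≱ i<odd
              (ℕₚ.≤-trans (step⇒mono point-step (s≤s (double-mono s≤t))) odd≤i)
      ... | no s≰t  = ℕₚ.<⇒≱ i<even
              (ℕₚ.≤-trans (step⇒mono point-step (double-mono (ℕₚ.≰⇒> s≰t))) even≤i)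

      -- `U` contains `A` or its complement. Either one omits every second interval, and the left
      -- endpoints of the omitted intervals become `φ`.
      A : Carrier
      A = ⋁ λ w → Lift (c ⊔ ℓ) (Σ[ i ∈ ℕ ] (InEvenInterval i × w ≡ a i))

      A-disjoint : ∀ {i} → Not (InEvenInterval i) → (A ∧ a i) ≈ ⊥
      A-disjoint {i} i∉ = ≤-disjoint x∧y≤y (≤-trans x∧y≤x (⋁-least _ _ λ where
        _ (lift (j , j∈ , refl)) → ∧≈⊥⇒≤compl (a-disjoint λ { refl → i∉ j∈ })))

      -- The bound by `z (point t)` is guaranteed from `point (suc t)` on; the indices before that
      -- form the interval omitted by `v`.
      sparsen : ∀ v t → (∀ i → point t ≤ i → i < point (suc t) → (v ∧ a i) ≈ ⊥) →
        ∀ i → point t ≤ i → ((x₀ ∧ v) ∧ a i) ≤ᴮ z (point t)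
      sparsen v t v-empty i t≤i with i ℕ.<? point (suc t)
      ... | yes i< = ≤-trans (∧-mono x∧y≤y ≤-refl)
              (≤-trans (≤-reflexive (v-empty i t≤i i<)) ⊥-least)
      ... | no i≮  = ≤-trans (∧-mono x∧y≤x ≤-refl)
              (below (point t) i (ℕₚ.≤-trans (h≤point t) (ℕₚ.≮⇒≥ i≮)))

      sparse : U x₀ → Σ[ x ∈ Carrier ] (U x × Σ[ φ ∈ (ℕ → ℕ) ] (StrictlyIncreasing φ ×
        (∀ t i → φ t ≤ i → (x ∧ a i) ≤ᴮ z (φ t))))
      sparse ux₀ with U-ultra A
      ... | inj₁ uA = x₀ ∧ A , U-∧ ux₀ uA , odds , odds↑ , λ t → sparsen A (suc (double t))
              λ i t≤i i< → A-disjoint (odd-notInEvenInterval {t} t≤i i<)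
      ... | inj₂ u¬A = x₀ ∧ compl A , U-∧ ux₀ u¬A , evens , evens↑ , λ t →
              sparsen (compl A) (double t) λ i t≤i i< → ≤-disjoint {y = A}
                (≤-trans x∧y≤y (⋁-ub _ _ (lift (i , (t , t≤i , i<) , refl)))) x∧y≤x

  sparse-pseudoIntersection : (z : ℕ → Carrier) → (∀ n → U (z n)) →
    Σ[ x ∈ Carrier ] (U x × Σ[ φ ∈ (ℕ → ℕ) ] (StrictlyIncreasing φ ×
      (∀ t i → φ t ≤ i → (x ∧ a i) ≤ᴮ z (φ t))))
  sparse-pseudoIntersection z z-U =
    let x₀ , ux₀ , h , below = pseudoIntersection z z-U in
    Sparse.sparse z x₀ h below (point h)
      (λ t → ℕₚ.m≤m+n (suc (point h t)) (h (point h t)))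
      (λ t → ℕₚ.m≤n+m (h (point h t)) (suc (point h t)))
      ux₀
    where
    point : (ℕ → ℕ) → ℕ → ℕ
    point h zero    = 0
    point h (suc t) = suc (point h t) + h (point h t)

  -- Finitely many patterns

  finiteMeet : (f : ℕ → Carrier) → (∀ n → U (f n)) → ∀ N →
    Σ[ z ∈ Carrier ] (U z × (∀ n → n < N → z ≤ᴮ f n))
  finiteMeet f f-U zero    = ⊤ , U-⊤ , λ _ ()
  finiteMeet f f-U (suc N) with finiteMeet f f-U N
  ... | z , uz , z≤ = z ∧ f N , U-∧ uz (f-U N) , λ n n<1+N →
    [ (λ n<N → ≤-trans x∧y≤x (z≤ n n<N)) , (λ { refl → x∧y≤y }) ]′
      (ℕₚ.m≤n⇒m<n∨m≡n (s≤s⁻¹ n<1+N))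

  -- One member of Q is chosen for each of the finitely many patterns that
  -- members of Q realise on the first l pieces with values d 0, …, d (N - 1).
  patternMeet : (d : ℕ → Carrier) (N l : ℕ) (Q : Pred) → Q ⊆ U →
    Σ[ z ∈ Carrier ] (U z × (∀ v → Q v →
      (∀ i → i < l → Σ[ k ∈ ℕ ] (k < N × (a i ∧ v) ≈ d k)) →
      Σ[ y ∈ Carrier ] (Q y × (∀ i → i < l → (a i ∧ v) ≈ (a i ∧ y)) × z ≤ᴮ y)))
  -- Only the empty pattern remains, so one member of `Q` serves for all; if there is none, `⊤` is a
  -- harmless default.
  patternMeet d N zero Q Q⊆U with em {Σ[ y ∈ Carrier ] Q y}
  ... | yes (y , Qy) = y , Q⊆U y Qy , λ _ _ _ → y , Qy , (λ _ ()) , ≤-refl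
  ... | no ∄y        = ⊤ , U-⊤ , λ v Qv _ → ⊥-elim (∄y (v , Qv))
  patternMeet d N (suc l) Q Q⊆U =
    let z , uz , z≤ = finiteMeet (proj₁ ∘ rec) (proj₁ ∘ proj₂ ∘ rec) N in
    z , uz , λ v Qv pattern′ →
      let k , k<N , v≈ = pattern′ l ℕₚ.≤-refl
          y , (Qy , lift y≈) , agree , zk≤y =
            proj₂ (proj₂ (rec k)) v (Qv , lift v≈) λ i i<l → pattern′ i (ℕₚ.m<n⇒m<1+n i<l)
      in y , Qy ,
         (λ i i<1+l → [ agree i , (λ { refl → ≈-trans v≈ (≈-sym y≈) }) ]′
                        (ℕₚ.m≤n⇒m<n∨m≡n (s≤s⁻¹ i<1+l))) ,
         ≤-trans (z≤ k k<N) zk≤y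
    where
    -- Members of `Q` are sorted by their top piece; the recursion treats the lower pieces.
    rec : ∀ k → _
    rec k = patternMeet d N l (λ v → Q v × Lift c ((a l ∧ v) ≈ d k)) (λ v → Q⊆U v ∘ proj₁)

  -- Tails of the antichain and the elements `power a v l`

  tail : ℕ → Carrier
  tail l = ⋁ λ y → Lift (c ⊔ ℓ) (Σ[ i ∈ ℕ ] (l ≤ i × y ≡ a i))

  -- `tail 0` is everything by maximality. As `a l` is not in `U`, its complement is, and meeting
  -- with it removes one more piece.
  U-tail : (∀ i → Not (U (a i))) → ∀ l → U (tail l)
  U-tail a∉U zero = U-up U-⊤ (≤-piecewise λ i →
    ≤-trans x∧y≤x (⋁-ub _ _ (lift (i , z≤n , refl))))
  U-tail a∉U (suc l) with U-ultra (a l)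
  ... | inj₁ ual  = ⊥-elim (a∉U l ual)
  ... | inj₂ u¬al = U-up (U-∧ u¬al (U-tail a∉U l))
          (≤-trans (∧-greatest x∧y≤y x∧y≤x) (uncurry (⋁-least _ _ λ where
            _ (lift (i , l≤i , refl)) → curry (lemma i (ℕₚ.m≤n⇒m<n∨m≡n l≤i)))))
    where
    lemma : ∀ i → l < i ⊎ l ≡ i → (a i ∧ compl (a l)) ≤ᴮ tail (suc l)
    lemma i (inj₁ l<i)  = ≤-trans x∧y≤x (⋁-ub _ _ (lift (i , l<i , refl)))
    lemma i (inj₂ refl) = ≤-trans (≤-reflexive (≤-disjoint x∧y≤x x∧y≤y)) ⊥-least

  power-least : ∀ {v w} l → (∀ i → i < l → (a i ∧ v) ≤ᴮ w) → (∀ i → l ≤ i → a i ≤ᴮ w) →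
    power a v l ≤ᴮ w
  power-least l lo hi = ∨-least
    (⋁-least _ _ λ { _ (lift (i , i<l , refl)) → lo i i<l })
    (⋁-least _ _ λ { _ (lift (i , l≤i , refl)) → hi i l≤i })

  ∧≤power : ∀ {v} l i → (a i ∧ v) ≤ᴮ power a v l
  ∧≤power l i with i ℕ.<? l
  ... | yes i<l = ≤-trans (⋁-ub _ _ (lift (i , i<l , refl))) x≤x∨y
  ... | no i≮l  = ≤-trans x∧y≤x (≤-trans (⋁-ub _ _ (lift (i , ℕₚ.≮⇒≥ i≮l , refl))) y≤x∨y)

  ≤power : ∀ {v} l → v ≤ᴮ power a v l
  ≤power l = ≤-piecewise (∧≤power l)

  power-mono : ∀ {v w} l → v ≤ᴮ w → power a v l ≤ᴮ power a w l
  power-mono l v≤w = power-least l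
    (λ i _ → ≤-trans (∧-mono ≤-refl v≤w) (∧≤power l i))
    (λ i l≤i → ≤-trans (⋁-ub _ _ (lift (i , l≤i , refl))) y≤x∨y)

  -- Values of `g` disjoint from elements of the dense set

  module _ (d : ℕ → Carrier) (g : PFun U) where

    Avoids : ℕ → Pred
    Avoids k v = Σ[ u ∈ U v ] Lift c ((g v u ∧ d k) ≈ ⊥)

    -- `l` bounds the pattern length and the indices of its values, as in `Cφ` at `l = φ (m j)`, and
    -- also the avoided `k`. The witness `y` depends on the pattern; `z` does not.
    AvoidanceBound : ℕ → Carrier → Set (c ⊔ ℓ)
    AvoidanceBound l z = ∀ k → k < l → ∀ v → Avoids k v →
      (∀ i → i < l → Σ[ j ∈ ℕ ] (j < l × (a i ∧ v) ≈ d j)) →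
      Σ[ y ∈ Carrier ] (Avoids k y × (∀ i → i < l → (a i ∧ v) ≈ (a i ∧ y)) × z ≤ᴮ y)

    avoidanceMeet : ∀ l → Σ[ z ∈ Carrier ] (U z × AvoidanceBound l z)
    avoidanceMeet l =
      let z , uz , z≤ = finiteMeet (proj₁ ∘ pm) (proj₁ ∘ proj₂ ∘ pm) l in
      z , uz , λ k k<l v Av pattern′ →
        let y , Ay , agree , zk≤y = proj₂ (proj₂ (pm k)) v Av pattern′
        in y , Ay , agree , ≤-trans (z≤ k k<l) zk≤y
      where
      pm : ∀ k → _
      pm k = patternMeet d l l (Avoids k) (λ _ → proj₁)

  -- The extension `g*` and its agreement with `g`

  module Extension (a∉U : ∀ i → Not (U (a i))) (g : PFun U) (g-mono : Monotonic U g)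
    (x : Carrier) (ux : U x) where

    -- `g` accepts only members of `U`. The default `⊥` keeps the total function monotonic because
    -- `U` is closed upwards.
    ĝ : Carrier → Carrier
    ĝ y = [ g (y ∧ x) , (λ _ → ⊥) ]′ (U-ultra (y ∧ x))

    -- The value of `g` may vary with the membership proof only up to `≈`, by monotonicity in both
    -- directions.
    ĝ≈g : ∀ y (u : U (y ∧ x)) → ĝ y ≈ g (y ∧ x) u
    ĝ≈g y u with U-ultra (y ∧ x)
    ... | inj₁ u′ = ≤-antisym (g-mono _ _ u′ u ≤-refl) (g-mono _ _ u u′ ≤-refl)
    ... | inj₂ u¬ = ⊥-elim (U-disjoint u u¬)

    ĝ-mono : ∀ {y z} → y ≤ᴮ z → ĝ y ≤ᴮ ĝ z
    ĝ-mono {y} {z} y≤z with U-ultra (y ∧ x)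
    ... | inj₂ _ = ⊥-least
    ... | inj₁ u = ≤-trans (g-mono _ _ u u′ (∧-mono y≤z ≤-refl)) (≤-reflexive (≈-sym (ĝ≈g z u′)))
      where u′ = U-up u (∧-mono y≤z ≤-refl)

    ĝ-cong : ∀ y z → y ≈ z → ĝ y ≈ ĝ z
    ĝ-cong y z y≈z = ≤-antisym (ĝ-mono (≤-reflexive y≈z)) (ĝ-mono (≤-reflexive (≈-sym y≈z)))

    g* : Carrier → Carrier
    g* v = ⋀ λ z → Lift (c ⊔ ℓ) (Σ[ l ∈ ℕ ] z ≡ ĝ (power a v l))

    g*≤ : ∀ v l → g* v ≤ᴮ ĝ (power a v l)
    g*≤ v l = ⋀-lb _ _ (lift (l , refl))

    g*-mono : ∀ {v w} → v ≤ᴮ w → g* v ≤ᴮ g* w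
    g*-mono {v} v≤w = ⋀-greatest _ _ λ where
      _ (lift (l , refl)) → ≤-trans (g*≤ v l) (ĝ-mono (power-mono l v≤w))

    -- `power a v l` contains `tail l` whatever `v` is. Hence the default of `ĝ` never enters `g*`,
    -- even for `v` outside `U`.
    U-power∧x : ∀ v l → U (power a v l ∧ x)
    U-power∧x v l = U-∧ (U-up (U-tail a∉U l) y≤x∨y) ux

    g≤g* : ∀ v (u : U v) → v ≤ᴮ x → g v u ≤ᴮ g* v
    g≤g* v u v≤x = ⋀-greatest _ _ λ where
      _ (lift (l , refl)) → ≤-trans
        (g-mono _ _ u (U-power∧x v l) (∧-greatest (≤power l) v≤x))
        (≤-reflexive (≈-sym (ĝ≈g _ (U-power∧x v l))))

    -- One factor of the meet suffices: `power a v l ∧ x` lies below `y`, by agreement of the pieces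
    -- below `l` and by the control through `x` from `l` on.
    g*≤g : ∀ v l y (uy : U y) → (∀ i → i < l → (a i ∧ v) ≈ (a i ∧ y)) →
      (∀ i → l ≤ i → (x ∧ a i) ≤ᴮ y) → g* v ≤ᴮ g y uy
    g*≤g v l y uy agree above = ≤-trans (g*≤ v l)
      (≤-trans (≤-reflexive (ĝ≈g _ (U-power∧x v l))) (g-mono _ _ _ uy (uncurry (power-least l
        (λ i i<l → ≤-trans (≤-reflexive (agree i i<l)) (≤-trans x∧y≤y y≤x∨y))
        (λ i l≤i → curry (≤-trans (∧-greatest x∧y≤y x∧y≤x) (above i l≤i)))))))

    -- By density, a failure yields a nonzero `d k` below `g* v` and disjoint from `g v u`. The
    -- witness `y` from `z-bound` then puts `g* v` below a value of `g` that misses `d k`.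
    g*≈g : (d : ℕ → Carrier) → (∀ w → Nonzero w → Σ[ k ∈ ℕ ] (Nonzero (d k) × d k ≤ᴮ w)) →
      (z : ℕ → Carrier) → (∀ l → AvoidanceBound d g l (z l)) →
      (φ : ℕ → ℕ) → StrictlyIncreasing φ → (∀ t i → φ t ≤ i → (x ∧ a i) ≤ᴮ z (φ t)) →
      ∀ v → Cφ d a φ v → (u : U v) → v ≤ᴮ x → g* v ≈ g v u
    g*≈g d d-dense z z-bound φ φ↑ above v (lift (m , m↑ , pattern′)) u v≤x =
      ≤-antisym (≤-stable λ nz → ⊥-elim (refute (d-dense _ nz))) (g≤g* v u v≤x)
      where
      refute : Not (Σ[ k ∈ ℕ ] (Nonzero (d k) × d k ≤ᴮ (g* v ∧ compl (g v u))))
      refute (k , nz , dk≤) =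
        -- The index `suc k` forces `k < l`, since `m` and `φ` dominate the identity.
        let l   = φ (m (suc k))
            k<l = ℕₚ.≤-trans (strictlyIncreasing⇒≥id m↑ (suc k))
                    (strictlyIncreasing⇒≥id φ↑ (m (suc k)))
            y , (uy , lift gy∧dk≈⊥) , agree , z≤y = z-bound l k k<l v
              (u , lift (≤-disjoint x∧y≤x (≤-trans x∧y≤y (≤-trans dk≤ x∧y≤y))))
              (pattern′ (suc k))
            dk≤gy = ≤-trans dk≤ (≤-trans x∧y≤x (g*≤g v l y uy agree
                      (λ i l≤i → ≤-trans (above (m (suc k)) i l≤i) z≤y)))
        in nz (≤⊥⇒≈⊥ (≤-trans (∧-greatest dk≤gy ≤-refl) (≤-reflexive gy∧dk≈⊥)))

theorem5p7 : {c ℓ : Level} → ExcludedMiddle (c ⊔ ℓ) →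
    (B : CompleteBooleanAlgebra c ℓ) →
    (d : ℕ → CompleteBooleanAlgebra.Carrier B) →
    (a : ℕ → CompleteBooleanAlgebra.Carrier B) →
    Ops.IsCohenWith B d → Ops.IsMaxAntichainSeq B a →
    (U : Ops.Pred B) → Ops.IsCoherentPUltrafilter B U →
    (∀ i → Not (U (a i))) →
    (g : Ops.PFun B U) → Ops.Monotonic B U g →
    Σ[ x ∈ CompleteBooleanAlgebra.Carrier B ] (U x ×
    Σ[ φ ∈ (ℕ → ℕ) ] (StrictlyIncreasing φ ×
    Σ[ gs ∈ Ops.PFun B (Ops.Cφ B d a φ) ]
    (Ops.Monotonic B (Ops.Cφ B d a φ) gs
    × Ops.RepresentedByBasicMap B a (Ops.Cφ B d a φ) gs
    × (∀ c (cφ : Ops.Cφ B d a φ c) (cu : U c) →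
    CompleteBooleanAlgebra._≤ᴮ_ B c x →
    CompleteBooleanAlgebra._≈_ B (gs c cφ) (g c cu)))))
theorem5p7 em B d a (_ , _ , _ , _ , _ , _ , d-dense) a-max U U-coh a∉U g g-mono =
  let open CoherentPUltrafilter em B a a-max U U-coh
      z = proj₁ ∘ avoidanceMeet d g
      x , ux , φ , φ↑ , above = sparse-pseudoIntersection z (proj₁ ∘ proj₂ ∘ avoidanceMeet d g)
      open Extension a∉U g g-mono x ux
  in x , ux , φ , φ↑ , (λ v _ → g* v) , (λ _ _ _ _ → g*-mono) ,
     -- The basic map is `ĝ`; `g*` is by definition the meet of its values on the powers.
     (ĝ , ĝ-cong , λ _ _ → CompleteBooleanAlgebra.refl B) ,
     g*≈g d d-dense z (proj₂ ∘ proj₂ ∘ avoidanceMeet d g) φ φ↑ above
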